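{- Let $a$ be an atomic proposition. No WMPL sentence (over any finite set $AP$ with $a\in AP$) expresses the $a$-acceptance property. Moreover, $\mathrm{WMPL}\equiv\mathrm{FO}$, $\mathrm{MPL}\equiv\mathrm{coWMPL}$, and $\mathrm{WMPL}<\mathrm{MPL}$. All these statements hold both over the class of all Kripke trees and over the class of finitely-branching Kripke trees.
   Context: Trees. A tree $T$ is a subset of $\mathbb{N}^*$ (finite words over the naturals) with an element $\tau_0\in T$ (the root) such that every $\tau\in T$ has the form $\tau_0\cdot\tau'$ with $\tau'\in\mathbb{N}^*$, and whenever $\tau_0\cdot\tau\in T$ and $\tau'$ is a prefix of $\tau$, also $\tau_0\cdot\tau'\in T$. Elements of $T$ are nodes. A child of $\tau$ in $T$ is a node of $T$ of the form $\tau\cdot n$, $n\in\mathbb{N}$; a descendant of $\tau$ in $T$ is a node of $T$ of the form $\tau\cdot\tau'$, $\tau'\in\mathbb{N}^*$ (so $\tau$ is a descendant of itself). A subtree of $T$ is a subset of $T$ that is a tree (with any root). A path of $T$ is a subtree of $T$ each of whose nodes has at most one child in it. $T$ is non-blocking if every node has a child in $T$, and finitely-branching if every node has finitely many children in $T$. For a finite set $AP$ of atomic propositions, a Kripke tree over $AP$ is a pair $(T,\mathrm{Lab})$ with $T$ a non-blocking tree and $\mathrm{Lab}:T\to 2^{AP}$; it is finitely-branching if $T$ is. Logics. Formulas over $AP$ are generated by $\varphi ::= P_p(x)\mid x\le y\mid x\in X\mid \neg\varphi\mid\varphi\wedge\varphi\mid\exists x.\varphi\mid\exists^{\alpha}X.\varphi$,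 with $p\in AP$, $x,y$ first-order variables, $X$ second-order variables. Over $(T,\mathrm{Lab})$, first-order variables range over nodes of $T$; $P_p(x)$ holds iff $p\in\mathrm{Lab}(x)$; $x\le y$ holds iff $y$ is a descendant of $x$ in $T$; $x\in X$ is membership; Boolean connectives and $\exists x$ are standard. In MPL (monadic path logic) second-order quantification ranges over all paths of $T$; in WMPL over the finite paths of $T$; in coWMPL over the infinite paths of $T$. FO is the first-order fragment (no second-order quantifiers or variables). A logic consists of its sentences. $a$-acceptance. A Kripke tree satisfies the $a$-acceptance property if each infinite path starting at its root visits a node whose label contains $a$ (the property of the CTL* formula $\mathsf{A}\mathsf{F}a$). A sentence expresses a property over a class of Kripke trees if the members of the class satisfying it are exactly those having the property. Expressiveness. Over a class of Kripke trees, two sentences over the same $AP$ are equivalent if they are satisfied by the same members (over $AP$) of the class. $L\le L'$ means that, for every finite $AP$, each $L$-sentence over $AP$ has an equivalent $L'$-sentence over $AP$; $L\equiv L'$ means $L\le L'$ and $L'\le L$; $L<L'$ means $L\le L'$ and $L'\not\le L$. -}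

module Defs where

open import Data.Fin.Base using (Fin)
open import Data.List.Base using (List; _++_; _∷ʳ_)
import Data.List.Membership.Propositional as List
open import Data.Nat.Base using (ℕ; suc)
open import Data.Product.Base using (Σ; Σ-syntax; ∃; _×_; proj₁)
open import Data.Unit.Base using (⊤)
open import Data.Vec.Base using (Vec; []; _∷_; lookup)
open import Function.Bundles using (_↔_; _⇔_)
open import Level using (0ℓ; Lift) renaming (suc to lsuc)
open import Relation.Binary.PropositionalEquality.Core using (_≡_)
open import Relation.Nullary.Negation.Core using (¬_)
open import Relation.Unary using (Pred; _∈_; _⊆_; _≐_)

FiniteSubset : {A : Set} → Pred A 0ℓ → Set
FiniteSubset S = ∃ λ xs → S ≐ (List._∈ xs)

FiniteSet : Set → Set
FiniteSet A = ∃ λ k → A ↔ Fin k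

Word : Set
Word = List ℕ

Subset : Set₁
Subset = Pred Word 0ℓ

infix 4 _⊑_

_⊑_ : Word → Word → Set
τ ⊑ σ = ∃ λ ρ → σ ≡ τ ++ ρ

record IsTree (T : Subset) : Set where
  field
    root   : Word
    root∈  : root ∈ T
    rooted : ∀ {τ} → τ ∈ T → root ⊑ τ
    closed : ∀ {τ τ′} → root ++ τ ∈ T → τ′ ⊑ τ → root ++ τ′ ∈ T

Child : Subset → Word → Pred Word 0ℓ
Child T τ σ = σ ∈ T × ∃ λ n → σ ≡ τ ∷ʳ n

Descendant : Subset → Word → Pred Word 0ℓ
Descendant T τ σ = σ ∈ T × τ ⊑ σ

record IsSubtree (T S : Subset) : Set where
  field
    included : S ⊆ T
    isTree   : IsTree S

record IsPath (T P : Subset) : Set where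
  field
    isSubtree  : IsSubtree T P
    atMostOne  : ∀ {τ σ σ′} → τ ∈ P → σ ∈ Child P τ → σ′ ∈ Child P τ → σ ≡ σ′

  open IsSubtree isSubtree public
  open IsTree isTree public

NonBlocking : Subset → Set
NonBlocking T = ∀ {τ} → τ ∈ T → ∃ λ σ → σ ∈ Child T τ

FinitelyBranching : Subset → Set
FinitelyBranching T = ∀ {τ} → τ ∈ T → FiniteSubset (Child T τ)

-- The labelling is total on words, but only its values on nodes of the
-- tree are ever consulted.

record KripkeTree (AP : Set) : Set₁ where
  field
    nodes       : Subset
    isTree      : IsTree nodes
    nonBlocking : NonBlocking nodes
    label       : Word → Pred AP 0ℓ

  open IsTree isTree public

module _ {AP : Set} where

  Node : KripkeTree AP → Set
  Node K = Σ[ τ ∈ Word ] τ ∈ KripkeTree.nodes K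

  Path : KripkeTree AP → Set₁
  Path K = Σ[ P ∈ Subset ] IsPath (KripkeTree.nodes K) P

data Logic : Set where
  FO MPL WMPL coWMPL : Logic

data SecondOrder : Logic → Set where
  mpl    : SecondOrder MPL
  wmpl   : SecondOrder WMPL
  cowmpl : SecondOrder coWMPL

-- Formula L AP m n: the L-formulas over AP with m first-order and n
-- second-order free variables, as de Bruijn indices into two separate
-- contexts.  A closed FO-formula contains no second-order variables,
-- since only ∃² could bring them into scope.

data Formula (L : Logic) (AP : Set) (m n : ℕ) : Set where
  P    : AP → Fin m → Formula L AP m n
  _≤ᶠ_ : Fin m → Fin m → Formula L AP m n
  _∈ᶠ_ : Fin m → Fin n → Formula L AP m n
  ¬ᶠ_  : Formula L AP m n → Formula L AP m n
  _∧ᶠ_ : Formula L AP m n → Formula L AP m n → Formula L AP m n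
  ∃¹   : Formula L AP (suc m) n → Formula L AP m n
  ∃²   : SecondOrder L → Formula L AP m (suc n) → Formula L AP m n

Sentence : Logic → Set → Set
Sentence L AP = Formula L AP 0 0

InRange : ∀ {L} → SecondOrder L → Subset → Set
InRange mpl    X = ⊤
InRange wmpl   X = FiniteSubset X
InRange cowmpl X = ¬ FiniteSubset X

module _ {L : Logic} {AP : Set} (K : KripkeTree AP) where

  open KripkeTree K using (nodes; label)

  Sat : ∀ {m n} → Vec (Node K) m → Vec (Path K) n → Formula L AP m n → Set₁
  Sat ν π (P p x)   = Lift (lsuc 0ℓ) (p ∈ label (proj₁ (lookup ν x)))
  Sat ν π (x ≤ᶠ y)  = Lift (lsuc 0ℓ)
    (proj₁ (lookup ν y) ∈ Descendant nodes (proj₁ (lookup ν x)))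
  Sat ν π (x ∈ᶠ X)  = Lift (lsuc 0ℓ) (proj₁ (lookup ν x) ∈ proj₁ (lookup π X))
  Sat ν π (¬ᶠ φ)    = ¬ Sat ν π φ
  Sat ν π (φ ∧ᶠ ψ)  = Sat ν π φ × Sat ν π ψ
  Sat ν π (∃¹ φ)    = Σ[ v ∈ Node K ] Sat (v ∷ ν) π φ
  Sat ν π (∃² so φ) = Σ[ X ∈ Path K ] InRange so (proj₁ X) × Sat ν (X ∷ π) φ

infix 4 _⊨_

_⊨_ : ∀ {L AP} → KripkeTree AP → Sentence L AP → Set₁
K ⊨ φ = Sat K [] [] φ

data TreeClass : Set where
  allTrees finitelyBranching : TreeClass

infix 4 _∈ᶜ_

_∈ᶜ_ : ∀ {AP} → KripkeTree AP → TreeClass → Set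
K ∈ᶜ allTrees          = ⊤
K ∈ᶜ finitelyBranching = FinitelyBranching (KripkeTree.nodes K)

Acceptance : ∀ {AP} → AP → KripkeTree AP → Set₁
Acceptance a K = (X : Subset) (isPath : IsPath nodes X) →
  IsPath.root isPath ≡ root → ¬ FiniteSubset X →
  ∃ λ τ → τ ∈ X × a ∈ label τ
  where open KripkeTree K

Expresses : ∀ {L AP} → TreeClass → Sentence L AP → (KripkeTree AP → Set₁) → Set₁
Expresses {AP = AP} C φ Property =
  (K : KripkeTree AP) → K ∈ᶜ C → K ⊨ φ ⇔ Property K

Equivalent : ∀ {L L′ AP} → TreeClass → Sentence L AP → Sentence L′ AP → Set₁
Equivalent {AP = AP} C φ ψ = (K : KripkeTree AP) → K ∈ᶜ C → K ⊨ φ ⇔ K ⊨ ψ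

infix 4 _≤[_]_ _≡[_]_ _<[_]_

_≤[_]_ : Logic → TreeClass → Logic → Set₁
L ≤[ C ] L′ = (AP : Set) → FiniteSet AP →
  (φ : Sentence L AP) → Σ[ ψ ∈ Sentence L′ AP ] Equivalent C φ ψ

_≡[_]_ : Logic → TreeClass → Logic → Set₁
L ≡[ C ] L′ = L ≤[ C ] L′ × L′ ≤[ C ] L

_<[_]_ : Logic → TreeClass → Logic → Set₁
L <[ C ] L′ = L ≤[ C ] L′ × ¬ (L′ ≤[ C ] L)

{-# OPTIONS --safe #-}
-- A finite path is an interval of the tree order, so quantifiers over
-- finite paths are first-order, and a path is finite iff it is bounded.
-- It remains to separate FO from acceptance.  Label the binary tree
-- {0,1}* by deep n: a holds from depth n on.  By finiteness of the number
-- of K-round types, deep n and deep m are K-equivalent for some n < m.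
-- With u = 0^(m−n), the tree deep m carries deep n at u; let limit be the
-- tree obtained by plugging deep m into itself at u forever.  It has the
-- a-free branch 0^ω.  By induction on k ≤ K, limit and deep n are
-- k-equivalent: a vertex of limit survives in a finite unfolding, which is
-- K-equivalent to deep n; a vertex of deep n has a counterpart in deep m,
-- not below u by symmetry, and replacing the subtree at u by the
-- k-equivalent limit gives its counterpart in limit.
module Submission where

open import Axiom.DoubleNegationElimination using (DoubleNegationElimination; em⇒dne)
open import Axiom.ExcludedMiddle using (ExcludedMiddle)
open import Data.Bool.Base using (Bool; true; false)
open import Data.Bool.Properties using (⇔→≡)
open import Data.Empty using (⊥; ⊥-elim)
open import Data.Fin.Base using (Fin; zero; suc; toℕ; combine; lift; opposite)
open import Data.Fin.Properties using (_≟_; combine-injective; pigeonhole; opposite-involutive; toℕ-injective; 1↔⊤)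
open import Data.List.Base using (List; []; _∷_; _++_; _∷ʳ_; allFin; filter; inits; length; map; replicate)
open import Data.List.Membership.Propositional using () renaming (_∈_ to _∈ˡ_)
open import Data.List.Membership.Propositional.Properties using (∈-allFin; ∈-filter⁺; ∈-filter⁻; ∈-map⁺; ∈-map⁻; ∈-++⁺ˡ; ∈-++⁺ʳ)
open import Data.List.Properties using (++-assoc; ++-identityʳ; ++-cancelˡ; ++-conicalˡ; length-++-≤ʳ; length-map; length-replicate; map-++; map-injective; ∷-injective; ∷ʳ-injectiveʳ)
open import Data.List.Relation.Unary.Any using (here; there)
open import Data.Nat.Base using (ℕ; zero; suc; _+_; _≤_; _<_; _⊔_; z≤n; s≤s; z<s; s<s)
open import Data.Nat.Properties using (_<?_; ≤-refl; ≤-trans; n<1+n; <⇒≤; <-irrefl; ≮⇒≥; m≤m+n; m≤n⇒∃[o]m+o≡n; m≤m⊔n; m≤n⊔m; +-comm)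
open import Data.Product.Base using (Σ-syntax; ∃₂; ∃-syntax; _×_; _,_; proj₁; proj₂)
open import Data.Product.Function.NonDependent.Propositional using (_×-⇔_)
open import Data.Sum.Base as Sum using (_⊎_; inj₁; inj₂)
open import Data.Unit.Base using (⊤; tt)
open import Data.Vec.Base using (Vec; []; _∷_; lookup)
import Data.Vec.Functional as F
open import Function.Base using (_∘_; id; flip)
open import Function.Bundles using (_⇔_; mk⇔; Equivalence)
open import Function.Construct.Composition using (_⇔-∘_)
open import Function.Construct.Identity using (⇔-id)
open import Function.Construct.Symmetry using (⇔-sym; ↔-sym)
open import Level using (0ℓ; Lift) renaming (suc to lsuc; lift to lift↑; lower to lower↓)
open import Relation.Binary.Construct.Composition using (_;_)
open import Relation.Binary.PropositionalEquality.Core using (_≡_; refl; sym; trans; cong; subst; subst₂)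
open import Relation.Nullary.Decidable.Core using (Dec; yes; no; map′)
open import Relation.Nullary.Negation.Core using (¬_; contradiction)
open import Relation.Unary using (Pred; _∈_; _≐_)
open import Defs

open Equivalence using (to; from)

-- The prefix order.

infix 4 _≼_

-- At ℕ this is the relation _⊑_ on words, definitionally.
_≼_ : {A : Set} → List A → List A → Set
τ ≼ σ = ∃[ ρ ] σ ≡ τ ++ ρ

module _ {A : Set} where

  ≼-refl : {τ : List A} → τ ≼ τ
  ≼-refl {τ} = [] , sym (++-identityʳ τ)

  ≼-trans : {τ σ υ : List A} → τ ≼ σ → σ ≼ υ → τ ≼ υ
  ≼-trans {τ} (ρ , refl) (ρ′ , refl) = ρ ++ ρ′ , ++-assoc τ ρ ρ′

  ++-mono-≼ : ∀ τ {σ υ : List A} → σ ≼ υ → τ ++ σ ≼ τ ++ υ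
  ++-mono-≼ τ {σ} (ρ , refl) = ρ , sym (++-assoc τ σ ρ)

  ++-cancel-≼ : ∀ τ {σ υ : List A} → τ ++ σ ≼ τ ++ υ → σ ≼ υ
  ++-cancel-≼ τ {σ} (ρ , eq) = ρ , ++-cancelˡ τ _ _ (trans eq (++-assoc τ σ ρ))

  ≼-antisym : {τ σ : List A} → τ ≼ σ → σ ≼ τ → τ ≡ σ
  ≼-antisym {τ} (ρ , refl) (ρ′ , eq) = sym (trans (cong (τ ++_) ρ≡[]) (++-identityʳ τ))
    where
    ρ≡[] : ρ ≡ []
    ρ≡[] = ++-conicalˡ ρ ρ′
      (sym (++-cancelˡ τ [] _ (trans (++-identityʳ τ) (trans eq (++-assoc τ ρ ρ′)))))

  ≼-++⁻ : ∀ τ σ {υ : List A} → σ ≼ τ ++ υ → τ ≼ σ ⊎ σ ≼ τ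
  ≼-++⁻ []      σ       _        = inj₁ (σ , refl)
  ≼-++⁻ (x ∷ τ) []      _        = inj₂ (x ∷ τ , refl)
  ≼-++⁻ (x ∷ τ) (y ∷ σ) (ρ , eq) with ∷-injective eq
  ... | refl , eq′ = Sum.map (++-mono-≼ (x ∷ [])) (++-mono-≼ (x ∷ [])) (≼-++⁻ τ σ (ρ , eq′))

  ∈-inits⁺ : {τ σ : List A} → τ ≼ σ → τ ∈ˡ inits σ
  ∈-inits⁺ {[]}    _          = here refl
  ∈-inits⁺ {x ∷ τ} (ρ , refl) = there (∈-map⁺ (x ∷_) (∈-inits⁺ {τ} (ρ , refl)))

-- Paths as chains, finite paths as intervals.

module Paths {T P : Subset} (isPath : IsPath T P) where

  open IsPath isPath

  convex : ∀ {τ σ} → root ⊑ τ → τ ⊑ σ → σ ∈ P → τ ∈ P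
  convex (ρ , refl) τ⊑σ σ∈P with rooted σ∈P
  ... | ρ′ , refl = closed σ∈P (++-cancel-≼ root τ⊑σ)

  private
    -- `υ` accumulates the common prefix: while both words continue, their next letters yield two
    -- children of `root ++ υ` in `P`, which `atMostOne` identifies.
    comparable-below : ∀ υ τ σ → root ++ (υ ++ τ) ∈ P → root ++ (υ ++ σ) ∈ P → τ ⊑ σ ⊎ σ ⊑ τ
    comparable-below υ []      σ       _ _ = inj₁ (σ , refl)
    comparable-below υ (m ∷ τ) []      _ _ = inj₂ (m ∷ τ , refl)
    comparable-below υ (m ∷ τ) (n ∷ σ) p q
      with ∷ʳ-injectiveʳ υ υ (++-cancelˡ root _ _ (atMostOne (closed p (m ∷ τ , refl)) (child m τ p) (child n σ q)))
      where
      child : ∀ k ρ → root ++ (υ ++ k ∷ ρ) ∈ P → root ++ (υ ∷ʳ k) ∈ Child P (root ++ υ)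
      child k ρ r = closed r (ρ , sym (++-assoc υ (k ∷ []) ρ)) , k , sym (++-assoc root υ (k ∷ []))
    ... | refl = Sum.map (++-mono-≼ (m ∷ [])) (++-mono-≼ (m ∷ []))
      (comparable-below (υ ∷ʳ m) τ σ (shift p) (shift q))
      where
      shift : ∀ {ρ} → root ++ (υ ++ m ∷ ρ) ∈ P → root ++ ((υ ∷ʳ m) ++ ρ) ∈ P
      shift {ρ} = subst (λ z → root ++ z ∈ P) (sym (++-assoc υ (m ∷ []) ρ))

  comparable : ∀ {τ σ} → τ ∈ P → σ ∈ P → τ ⊑ σ ⊎ σ ⊑ τ
  comparable τ∈P σ∈P with rooted τ∈P | rooted σ∈P
  ... | ρ , refl | ρ′ , refl =
    Sum.map (++-mono-≼ root) (++-mono-≼ root) (comparable-below [] ρ ρ′ τ∈P σ∈P)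

  Bounded : Set
  Bounded = ∃[ τ ] τ ∈ P × (∀ {σ} → σ ∈ P → σ ⊑ τ)

  finite⇒bounded : FiniteSubset P → Bounded
  finite⇒bounded (xs , P⊆xs , xs⊆P) with bound xs xs⊆P
    where
    bound : ∀ ys → (∀ {σ} → σ ∈ˡ ys → σ ∈ P) → ∃[ τ ] τ ∈ P × (∀ {σ} → σ ∈ˡ ys → σ ⊑ τ)
    -- The bound must lie in `P` even for the empty list; the root serves there.
    bound []       _    = root , root∈ , λ ()
    bound (y ∷ ys) ys⊆P with bound ys (ys⊆P ∘ there)
    ... | τ , τ∈P , ys⊑τ with comparable (ys⊆P (here refl)) τ∈P
    ...   | inj₁ y⊑τ = τ , τ∈P , λ { (here refl) → y⊑τ ; (there σ∈) → ys⊑τ σ∈ }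
    ...   | inj₂ τ⊑y = y , ys⊆P (here refl) , λ { (here refl) → ≼-refl ; (there σ∈) → ≼-trans (ys⊑τ σ∈) τ⊑y }
  ... | τ , τ∈P , xs⊑τ = τ , τ∈P , xs⊑τ ∘ P⊆xs

Interval : Subset → Word → Word → Subset
Interval T τ σ υ = υ ∈ Descendant T τ × σ ∈ Descendant T υ

⊑-bounded-children : ∀ {υ σ m n} → υ ∷ʳ m ⊑ σ → υ ∷ʳ n ⊑ σ → m ≡ n
⊑-bounded-children {υ} {m = m} {n} (ρ , refl) (ρ′ , eq) = proj₁ (∷-injective
  (++-cancelˡ υ _ _ (trans (sym (++-assoc υ (m ∷ []) ρ)) (trans eq (++-assoc υ (n ∷ []) ρ′)))))

-- Two children of one node that are both prefixes of `σ` coincide, and a word between `τ` and a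
-- node lies in `T` because `T` is closed under prefixes that extend its root.
interval-isPath : ∀ {T τ σ} → IsTree T → τ ∈ T → σ ∈ Descendant T τ → IsPath T (Interval T τ σ)
interval-isPath {T} {τ} {σ} isTree τ∈T (σ∈T , τ⊑σ) = record
  { isSubtree = record
    { included = proj₁ ∘ proj₁
    ; isTree   = record
      { root   = τ
      ; root∈  = (τ∈T , ≼-refl) , σ∈T , τ⊑σ
      ; rooted = proj₂ ∘ proj₁
      ; closed = λ ((υ∈T , _) , _ , υ⊑σ) ρ⊑ →
          (between (_ , refl) (++-mono-≼ τ ρ⊑) υ∈T , _ , refl) , σ∈T , ≼-trans (++-mono-≼ τ ρ⊑) υ⊑σ
      }
    }
  ; atMostOne = λ { _ ((_ , _ , p) , m , refl) ((_ , _ , q) , n , refl) →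
      cong (_ ∷ʳ_) (⊑-bounded-children p q) }
  }
  where
  open IsTree isTree

  between : ∀ {υ ρ} → τ ⊑ ρ → ρ ⊑ υ → υ ∈ T → ρ ∈ T
  between τ⊑ρ ρ⊑υ υ∈T with rooted υ∈T | ≼-trans (rooted τ∈T) τ⊑ρ
  ... | _ , refl | _ , refl = closed υ∈T (++-cancel-≼ root ρ⊑υ)

-- Translating path quantifiers between the logics.

data InfiniteQuantifier : Logic → Set where
  mpl    : InfiniteQuantifier MPL
  cowmpl : InfiniteQuantifier coWMPL

-- The paths over which a source quantifier ranges, as seen from the target logic. Finite paths are
-- available in every logic, being intervals; the other two cases need a quantifier that reaches
-- infinite paths.
data Range (L : Logic) : Set where
  finite   : Range L
  infinite : InfiniteQuantifier L → Range L
  any      : InfiniteQuantifier L → Range L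

Within : ∀ {L} → Range L → Subset → Set
Within finite       X = FiniteSubset X
Within (infinite _) X = ¬ FiniteSubset X
Within (any _)      X = ⊤

infixr 5 _∨ᶠ_

_∨ᶠ_ : ∀ {L AP m n} → Formula L AP m n → Formula L AP m n → Formula L AP m n
φ ∨ᶠ ψ = ¬ᶠ ((¬ᶠ φ) ∧ᶠ (¬ᶠ ψ))

-- For a path, having a greatest node amounts to being finite; negated, this singles out the
-- infinite paths in `MPL`.
boundedᶠ : ∀ {L AP m n} → Formula L AP m (suc n)
boundedᶠ = ∃¹ ((zero ∈ᶠ zero) ∧ᶠ (¬ᶠ ∃¹ ((zero ∈ᶠ zero) ∧ᶠ (¬ᶠ (zero ≤ᶠ suc zero)))))

∃∞ : ∀ {L AP m n} → InfiniteQuantifier L → Formula L AP m (suc n) → Formula L AP m n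
∃∞ mpl    φ = ∃² mpl ((¬ᶠ boundedᶠ) ∧ᶠ φ)
∃∞ cowmpl φ = ∃² cowmpl φ

∃ᶠⁱⁿ : ∀ {L AP m n} → Formula L AP (2 + m) n → Formula L AP m n
∃ᶠⁱⁿ φ = ∃¹ (∃¹ ((suc zero ≤ᶠ zero) ∧ᶠ φ))

-- The body comes in two translations: a finite path costs two node variables, its endpoints,
-- whereas an infinite path stays a path variable.
quantify : ∀ {L AP m n} → Range L → Formula L AP (2 + m) n → Formula L AP m (suc n) → Formula L AP m n
quantify finite       φ ψ = ∃ᶠⁱⁿ φ
quantify (infinite q) φ ψ = ∃∞ q ψ
quantify (any q)      φ ψ = ∃ᶠⁱⁿ φ ∨ᶠ ∃∞ q ψ

data PathTerm (m n : ℕ) : Set where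
  var      : Fin n → PathTerm m n
  interval : Fin m → Fin m → PathTerm m n

weaken¹ : ∀ {m n} → PathTerm m n → PathTerm (suc m) n
weaken¹ (var X)        = var X
weaken¹ (interval x y) = interval (suc x) (suc y)

weaken² : ∀ {m n} → PathTerm m n → PathTerm m (suc n)
weaken² (var X)        = var (suc X)
weaken² (interval x y) = interval x y

_∈ᵗ_ : ∀ {L AP m n} → Fin m → PathTerm m n → Formula L AP m n
x ∈ᵗ var X        = x ∈ᶠ X
x ∈ᵗ interval y z = (y ≤ᶠ x) ∧ᶠ (x ≤ᶠ z)

module _ {L L′ : Logic} (range : SecondOrder L → Range L′) {AP : Set} where

  translate : ∀ {m n m′ n′} → (Fin m → Fin m′) → (Fin n → PathTerm m′ n′) →
              Formula L AP m n → Formula L′ AP m′ n′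
  translate σ ρ (P p x)   = P p (σ x)
  translate σ ρ (x ≤ᶠ y)  = σ x ≤ᶠ σ y
  translate σ ρ (x ∈ᶠ X)  = σ x ∈ᵗ ρ X
  translate σ ρ (¬ᶠ φ)    = ¬ᶠ translate σ ρ φ
  translate σ ρ (φ ∧ᶠ ψ)  = translate σ ρ φ ∧ᶠ translate σ ρ ψ
  translate σ ρ (∃¹ φ)    = ∃¹ (translate (lift 1 σ) (weaken¹ ∘ ρ) φ)
  translate σ ρ (∃² so φ) = quantify (range so)
    -- `∃ᶠⁱⁿ` binds the lower endpoint first, so it has index 1 and the upper endpoint index 0.
    (translate (λ x → suc (suc (σ x))) (interval (suc zero) zero F.∷ weaken¹ ∘ weaken¹ ∘ ρ) φ)
    (translate σ (var zero F.∷ weaken² ∘ ρ) φ)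

Σ-cong-⇔ : ∀ {a b} {A : Set a} {B C : A → Set b} → (∀ x → B x ⇔ C x) → (Σ[ x ∈ A ] B x) ⇔ (Σ[ x ∈ A ] C x)
Σ-cong-⇔ e = mk⇔ (λ (x , y) → x , to (e x) y) (λ (x , y) → x , from (e x) y)

¬-cong-⇔ : ∀ {a b} {A : Set a} {B : Set b} → A ⇔ B → (¬ A) ⇔ (¬ B)
¬-cong-⇔ e = mk⇔ (_∘ from e) (_∘ to e)

-- Correctness of the translations, with excluded middle.

module Classical (em : ExcludedMiddle (lsuc 0ℓ)) where

  em₀ : ExcludedMiddle 0ℓ
  em₀ = map′ lower↓ lift↑ em

  dne : DoubleNegationElimination (lsuc 0ℓ)
  dne = em⇒dne em

  dne₀ : DoubleNegationElimination 0ℓ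
  dne₀ = em⇒dne em₀

  -- Excluded middle decides membership, so the list can be filtered down to `S`.
  ⊆-list⇒finite : ∀ {A : Set} {S : Pred A 0ℓ} xs → (∀ {x} → x ∈ S → x ∈ˡ xs) → FiniteSubset S
  ⊆-list⇒finite {S = S} xs S⊆xs =
    filter S? xs , (λ x∈S → ∈-filter⁺ S? (S⊆xs x∈S) x∈S) , λ x∈ → proj₂ (∈-filter⁻ S? {xs = xs} x∈)
    where
    S? : ∀ x → Dec (S x)
    S? x = em₀

  bounded⇒finite : ∀ {T P} (isPath : IsPath T P) → Paths.Bounded isPath → FiniteSubset P
  bounded⇒finite _ (τ , _ , P⊑τ) = ⊆-list⇒finite (inits τ) (∈-inits⁺ ∘ P⊑τ)

  module _ {AP : Set} (K : KripkeTree AP) where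

    open KripkeTree K

    ∨ᶠ-⇔ : ∀ {L m n} {ν : Vec (Node K) m} {π : Vec (Path K) n} (φ ψ : Formula L AP m n) →
           Sat K ν π (φ ∨ᶠ ψ) ⇔ (Sat K ν π φ ⊎ Sat K ν π ψ)
    ∨ᶠ-⇔ φ ψ = mk⇔
      (λ s → dne λ k → s ((λ p → k (inj₁ p)) , λ q → k (inj₂ q)))
      (λ { (inj₁ p) (¬p , _) → ¬p p ; (inj₂ q) (_ , ¬q) → ¬q q })

    boundedᶠ-⇔ : ∀ {L m n} {ν : Vec (Node K) m} {π : Vec (Path K) n} (X : Path K) →
                 Sat K ν (X ∷ π) (boundedᶠ {L}) ⇔ Lift (lsuc 0ℓ) (FiniteSubset (proj₁ X))
    boundedᶠ-⇔ (X , isPath) = mk⇔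
      (λ ((τ , _) , lift↑ τ∈X , max) → lift↑ (bounded⇒finite isPath
        (τ , τ∈X , λ {σ} σ∈X → dne₀ λ σ⋢τ → max ((σ , included σ∈X) , lift↑ σ∈X , λ (lift↑ (_ , σ⊑τ)) → σ⋢τ σ⊑τ))))
      (λ (lift↑ fin) → let τ , τ∈X , X⊑τ = finite⇒bounded fin in
        (τ , included τ∈X) , lift↑ τ∈X , λ (_ , lift↑ σ∈X , σ⋢τ) → σ⋢τ (lift↑ (included τ∈X , X⊑τ σ∈X)))
      where
      open IsPath isPath using (included)
      open Paths isPath

    ∃∞-⇔ : ∀ {L m n} {ν : Vec (Node K) m} {π : Vec (Path K) n} (q : InfiniteQuantifier L) φ →
           Sat K ν π (∃∞ q φ) ⇔ (Σ[ X ∈ Path K ] ¬ FiniteSubset (proj₁ X) × Sat K ν (X ∷ π) φ)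
    ∃∞-⇔ {ν = ν} {π} mpl φ = Σ-cong-⇔ λ X → mk⇔
      (λ (_ , unb , s) → (λ fin → unb (from (boundedᶠ-⇔ {MPL} {ν = ν} {π} X) (lift↑ fin))) , s)
      (λ (inf , s) → tt , (λ b → inf (lower↓ (to (boundedᶠ-⇔ {MPL} {ν = ν} {π} X) b))) , s)
    ∃∞-⇔ cowmpl φ = ⇔-id _

    ⟦_⟧ : ∀ {m n} → PathTerm m n → Vec (Node K) m → Vec (Path K) n → Subset
    ⟦ var X ⟧        ν π = proj₁ (lookup π X)
    ⟦ interval x y ⟧ ν π = Interval nodes (proj₁ (lookup ν x)) (proj₁ (lookup ν y))

    weaken¹-⟦⟧ : ∀ {m n} (t : PathTerm m n) {ν π v} → ⟦ weaken¹ t ⟧ (v ∷ ν) π ≡ ⟦ t ⟧ ν π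
    weaken¹-⟦⟧ (var X)        = refl
    weaken¹-⟦⟧ (interval x y) = refl

    weaken²-⟦⟧ : ∀ {m n} (t : PathTerm m n) {ν π X} → ⟦ weaken² t ⟧ ν (X ∷ π) ≡ ⟦ t ⟧ ν π
    weaken²-⟦⟧ (var X)        = refl
    weaken²-⟦⟧ (interval x y) = refl

    ∈ᵗ-⇔ : ∀ {L m n} {ν : Vec (Node K) m} {π : Vec (Path K) n} x (t : PathTerm m n) →
           Sat {L} K ν π (x ∈ᵗ t) ⇔ Lift (lsuc 0ℓ) (proj₁ (lookup ν x) ∈ ⟦ t ⟧ ν π)
    ∈ᵗ-⇔ x (var X)        = ⇔-id _
    ∈ᵗ-⇔ x (interval y z) = mk⇔ (λ (lift↑ p , lift↑ q) → lift↑ (p , q)) (λ (lift↑ (p , q)) → lift↑ p , lift↑ q)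

    -- The endpoints are the root of the path and its greatest node; convexity fills in everything
    -- between.
    finite-path-interval : ∀ {X} → IsPath nodes X → FiniteSubset X →
      ∃₂ λ (u v : Node K) → proj₁ v ∈ Descendant nodes (proj₁ u) × X ≐ Interval nodes (proj₁ u) (proj₁ v)
    finite-path-interval isPath fin with Paths.finite⇒bounded isPath fin
    ... | τ , τ∈X , X⊑τ = (P.root , P.included P.root∈) , (τ , P.included τ∈X) ,
      (P.included τ∈X , P.rooted τ∈X) ,
      (λ σ∈X → (P.included σ∈X , P.rooted σ∈X) , P.included τ∈X , X⊑τ σ∈X) ,
      (λ ((_ , r⊑σ) , _ , σ⊑τ) → Paths.convex isPath r⊑σ σ⊑τ τ∈X)
      where module P = IsPath isPath

    intervalPath : (u v : Node K) → proj₁ v ∈ Descendant nodes (proj₁ u) → Path K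
    intervalPath u v u≤v = Interval nodes (proj₁ u) (proj₁ v) , interval-isPath isTree (proj₂ u) u≤v

    intervalPath-finite : ∀ u v u≤v → FiniteSubset (proj₁ (intervalPath u v u≤v))
    intervalPath-finite u v u≤v = ⊆-list⇒finite (inits (proj₁ v)) λ (_ , _ , σ⊑v) → ∈-inits⁺ σ⊑v

    -- Nodes are compared as words and paths by extension: a finite path and the interval replacing
    -- it have the same elements but need not be equal as predicates.
    record Agree {m n m′ n′} (σ : Fin m → Fin m′) (ρ : Fin n → PathTerm m′ n′)
                 (ν : Vec (Node K) m) (π : Vec (Path K) n)
                 (ν′ : Vec (Node K) m′) (π′ : Vec (Path K) n′) : Set where
      constructor agree
      field
        nodes≡ : ∀ x → proj₁ (lookup ν x) ≡ proj₁ (lookup ν′ (σ x))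
        paths≐ : ∀ X → proj₁ (lookup π X) ≐ ⟦ ρ X ⟧ ν′ π′

    module _ {L L′} (range : SecondOrder L → Range L′)
             (range-⇔ : ∀ so X → InRange so X ⇔ Within (range so) X) where

      module _ {m n m′ n′} {σ : Fin m → Fin m′} {ρ : Fin n → PathTerm m′ n′} {ν π ν′ π′}
               (ag : Agree σ ρ ν π ν′ π′) where

        open Agree ag

        agree-∃¹ : ∀ v → Agree (lift 1 σ) (weaken¹ ∘ ρ) (v ∷ ν) π (v ∷ ν′) π′
        agree-∃¹ v = agree (λ { zero → refl ; (suc x) → nodes≡ x })
                           (λ X → subst (_ ≐_) (sym (weaken¹-⟦⟧ (ρ X))) (paths≐ X))

        agree-var : ∀ X → Agree σ (var zero F.∷ weaken² ∘ ρ) ν (X ∷ π) ν′ (X ∷ π′)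
        agree-var X = agree nodes≡ λ
          { zero    → id , id
          ; (suc Y) → subst (_ ≐_) (sym (weaken²-⟦⟧ (ρ Y))) (paths≐ Y) }

        agree-interval : ∀ X u v → proj₁ X ≐ Interval nodes (proj₁ u) (proj₁ v) →
          Agree (λ x → suc (suc (σ x))) (interval (suc zero) zero F.∷ weaken¹ ∘ weaken¹ ∘ ρ)
                ν (X ∷ π) (v ∷ u ∷ ν′) π′
        agree-interval X u v X≐ = agree nodes≡ λ
          { zero    → X≐
          ; (suc Y) → subst (_ ≐_) (sym (trans (weaken¹-⟦⟧ (weaken¹ (ρ Y))) (weaken¹-⟦⟧ (ρ Y)))) (paths≐ Y) }

      -- The essential case is the path quantifier: finite witnesses are exchanged for their
      -- endpoints, infinite ones are kept.
      translate-⇔ : ∀ {m n m′ n′} {σ : Fin m → Fin m′} {ρ : Fin n → PathTerm m′ n′} {ν π ν′ π′} →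
        Agree σ ρ ν π ν′ π′ → ∀ φ → Sat K ν π φ ⇔ Sat K ν′ π′ (translate range σ ρ φ)
      translate-⇔ (agree n≡ _) (P p x) rewrite n≡ x = ⇔-id _
      translate-⇔ (agree n≡ _) (x ≤ᶠ y) rewrite n≡ x | n≡ y = ⇔-id _
      translate-⇔ {σ = σ} {ρ} (agree n≡ p≐) (x ∈ᶠ X) rewrite n≡ x = ⇔-sym (∈ᵗ-⇔ (σ x) (ρ X)) ⇔-∘
        mk⇔ (λ (lift↑ p) → lift↑ (proj₁ (p≐ X) p)) (λ (lift↑ p) → lift↑ (proj₂ (p≐ X) p))
      translate-⇔ ag (¬ᶠ φ)   = ¬-cong-⇔ (translate-⇔ ag φ)
      translate-⇔ ag (φ ∧ᶠ ψ) = translate-⇔ ag φ ×-⇔ translate-⇔ ag ψ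
      translate-⇔ ag (∃¹ φ)   = Σ-cong-⇔ λ v → translate-⇔ (agree-∃¹ ag v) φ
      translate-⇔ {σ = σ} {ρ} {ν} {π} {ν′} {π′} ag (∃² so φ) =
        quantify-⇔ (range so) ⇔-∘ Σ-cong-⇔ (λ X → range-⇔ so (proj₁ X) ×-⇔ ⇔-id _)
        where
        φᶠ = translate range (λ x → suc (suc (σ x))) (interval (suc zero) zero F.∷ weaken¹ ∘ weaken¹ ∘ ρ) φ
        φ∞ = translate range σ (var zero F.∷ weaken² ∘ ρ) φ

        fin-⇔ : (Σ[ X ∈ Path K ] FiniteSubset (proj₁ X) × Sat K ν (X ∷ π) φ) ⇔ Sat K ν′ π′ (∃ᶠⁱⁿ φᶠ)
        fin-⇔ = mk⇔
          (λ (X , fin , s) → let u , v , u≤v , X≐ = finite-path-interval (proj₂ X) fin in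
            u , v , lift↑ u≤v , to (translate-⇔ (agree-interval ag X u v X≐) φ) s)
          (λ (u , v , lift↑ u≤v , s) → intervalPath u v u≤v , intervalPath-finite u v u≤v ,
            from (translate-⇔ (agree-interval ag (intervalPath u v u≤v) u v (id , id)) φ) s)

        inf-⇔ : ∀ q → (Σ[ X ∈ Path K ] ¬ FiniteSubset (proj₁ X) × Sat K ν (X ∷ π) φ) ⇔ Sat K ν′ π′ (∃∞ q φ∞)
        inf-⇔ q = ⇔-sym (∃∞-⇔ q φ∞) ⇔-∘ Σ-cong-⇔ λ X → ⇔-id _ ×-⇔ translate-⇔ (agree-var ag X) φ

        quantify-⇔ : ∀ r → (Σ[ X ∈ Path K ] Within r (proj₁ X) × Sat K ν (X ∷ π) φ) ⇔
                           Sat K ν′ π′ (quantify r φᶠ φ∞)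
        quantify-⇔ finite       = fin-⇔
        quantify-⇔ (infinite q) = inf-⇔ q
        quantify-⇔ (any q)      = ⇔-sym (∨ᶠ-⇔ (∃ᶠⁱⁿ φᶠ) (∃∞ q φ∞)) ⇔-∘ mk⇔ split join
          where
          split : _
          -- Excluded middle sorts the witnesses of the unrestricted quantifier into finite and
          -- infinite ones.
          split (X , _ , s) with em₀ {FiniteSubset (proj₁ X)}
          ... | yes fin = inj₁ (to fin-⇔ (X , fin , s))
          ... | no  inf = inj₂ (to (inf-⇔ q) (X , inf , s))
          join : _
          join (inj₁ s) = let X , _ , s′ = from fin-⇔ s in X , tt , s′
          join (inj₂ s) = let X , _ , s′ = from (inf-⇔ q) s in X , tt , s′

  ≤-by-translation : ∀ {L L′ C} (range : SecondOrder L → Range L′) →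
                     (∀ so X → InRange so X ⇔ Within (range so) X) → L ≤[ C ] L′
  ≤-by-translation range range-⇔ AP _ φ =
    translate range (λ ()) (λ ()) φ ,
    λ K _ → translate-⇔ K range range-⇔ (agree (λ ()) (λ ())) φ

  FO≤ : ∀ {L C} → FO ≤[ C ] L
  FO≤ = ≤-by-translation (λ ()) (λ ())

  WMPL≤ : ∀ {L C} → WMPL ≤[ C ] L
  WMPL≤ = ≤-by-translation (λ _ → finite) (λ { wmpl _ → ⇔-id _ })

  MPL≤coWMPL : ∀ {C} → MPL ≤[ C ] coWMPL
  MPL≤coWMPL = ≤-by-translation (λ _ → any cowmpl) (λ { mpl _ → ⇔-id _ })

  coWMPL≤MPL : ∀ {C} → coWMPL ≤[ C ] MPL
  coWMPL≤MPL = ≤-by-translation (λ _ → infinite mpl) (λ { cowmpl _ → ⇔-id _ })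

-- Ehrenfeucht-Fraïssé games on labelled binary trees.

Vertex : Set
Vertex = List (Fin 2)

Labelling : Set
Labelling = Vertex → Bool

Pairing : Set₁
Pairing = Vertex → Vertex → Set

record PartialIso (ℓ ℓ′ : Labelling) (R : Pairing) : Set where
  field
    labels : ∀ {x y} → R x y → ℓ x ≡ ℓ′ y
    order  : ∀ {x y x′ y′} → R x y → R x′ y′ → x ≼ x′ ⇔ y ≼ y′

open PartialIso

∅ : Pairing
∅ _ _ = ⊥

infixl 5 _⊹_↦_

data _⊹_↦_ (R : Pairing) (x y : Vertex) : Pairing where
  old : ∀ {x′ y′} → R x′ y′ → (R ⊹ x ↦ y) x′ y′
  new : (R ⊹ x ↦ y) x y

-- EF k ℓ ℓ′ R: Duplicator wins the k-round Ehrenfeucht–Fraïssé game on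
-- the binary trees labelled by ℓ and ℓ′ from the position in which the
-- pairs in R, possibly infinitely many, have been chosen.
EF : ℕ → Labelling → Labelling → Pairing → Set
EF zero    ℓ ℓ′ R = PartialIso ℓ ℓ′ R
EF (suc k) ℓ ℓ′ R = (∀ x → ∃[ y ] EF k ℓ ℓ′ (R ⊹ x ↦ y)) × (∀ y → ∃[ x ] EF k ℓ ℓ′ (R ⊹ x ↦ y))

infix 4 _≈[_]_

_≈[_]_ : Labelling → ℕ → Labelling → Set
ℓ ≈[ k ] ℓ′ = EF k ℓ ℓ′ ∅

⊹-mono : ∀ {R S : Pairing} {x y} → (∀ {x y} → R x y → S x y) →
         ∀ {x′ y′} → (R ⊹ x ↦ y) x′ y′ → (S ⊹ x ↦ y) x′ y′
⊹-mono R⊆S (old r) = old (R⊆S r)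
⊹-mono R⊆S new     = new

EF-antitone : ∀ k {ℓ ℓ′ R S} → (∀ {x y} → R x y → S x y) → EF k ℓ ℓ′ S → EF k ℓ ℓ′ R
EF-antitone zero    R⊆S e = record
  { labels = λ r → labels e (R⊆S r) ; order = λ r r′ → order e (R⊆S r) (R⊆S r′) }
EF-antitone (suc k) R⊆S (forth , back) =
  (λ x → let y , e = forth x in y , EF-antitone k (⊹-mono R⊆S) e) ,
  (λ y → let x , e = back y in x , EF-antitone k (⊹-mono R⊆S) e)

EF-pred : ∀ k {ℓ ℓ′ R} → EF (suc k) ℓ ℓ′ R → EF k ℓ ℓ′ R
-- A round is spent on the arbitrary vertex `[]`, and the extra pair is forgotten.
EF-pred k (forth , _) = EF-antitone k old (proj₂ (forth []))

EF-mono : ∀ {j k ℓ ℓ′ R} → j ≤ k → EF k ℓ ℓ′ R → EF j ℓ ℓ′ R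
EF-mono {k = zero}  z≤n       e = e
EF-mono {k = suc k} z≤n       e = EF-mono {k = k} z≤n (EF-pred k e)
EF-mono             (s≤s j≤k) (forth , back) =
  (λ x → let y , e = forth x in y , EF-mono j≤k e) ,
  (λ y → let x , e = back y in x , EF-mono j≤k e)

EF-sym : ∀ k {ℓ ℓ′ R} → EF k ℓ ℓ′ R → EF k ℓ′ ℓ (flip R)
EF-sym zero    e = record
  { labels = λ r → sym (labels e r) ; order = λ r r′ → ⇔-sym (order e r r′) }
EF-sym (suc k) {R = R} (forth , back) =
  (λ y → let x , e = back y in x , EF-antitone k swap (EF-sym k e)) ,
  (λ x → let y , e = forth x in y , EF-antitone k swap (EF-sym k e))
  where
  swap : ∀ {x y x′ y′} → (flip R ⊹ y ↦ x) y′ x′ → flip (R ⊹ x ↦ y) y′ x′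
  swap (old r) = old r
  swap new     = new

-- Duplicator composes strategies: the answer in the middle tree is played as Spoiler's move in the
-- other game.
EF-trans : ∀ k {ℓ ℓ′ ℓ″ R S} → EF k ℓ ℓ′ R → EF k ℓ′ ℓ″ S → EF k ℓ ℓ″ (R ; S)
EF-trans zero    e e′ = record
  { labels = λ (_ , r , s) → trans (labels e r) (labels e′ s)
  ; order  = λ (_ , r , s) (_ , r′ , s′) → order e′ s s′ ⇔-∘ order e r r′ }
EF-trans (suc k) {R = R} {S} (forth , back) (forth′ , back′) =
  (λ x → let y , e = forth x ; z , e′ = forth′ y in z , EF-antitone k via (EF-trans k e e′)) ,
  (λ z → let y , e′ = back′ z ; x , e = back y in x , EF-antitone k via (EF-trans k e e′))
  where
  via : ∀ {x y z x′ z′} → ((R ; S) ⊹ x ↦ z) x′ z′ → ((R ⊹ x ↦ y) ; (S ⊹ y ↦ z)) x′ z′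
  via (old (y , r , s)) = y , old r , old s
  via new               = _ , new , new

≈-sym : ∀ k {ℓ ℓ′} → ℓ ≈[ k ] ℓ′ → ℓ′ ≈[ k ] ℓ
≈-sym k e = EF-antitone k (λ ()) (EF-sym k e)

≈-trans : ∀ k {ℓ ℓ′ ℓ″} → ℓ ≈[ k ] ℓ′ → ℓ′ ≈[ k ] ℓ″ → ℓ ≈[ k ] ℓ″
≈-trans k e e′ = EF-antitone k (λ ()) (EF-trans k e e′)

-- Duplicator answers along the automorphism `f`. The game starts from the whole graph of `f`, an
-- infinite position, so every answer already belongs to it.
EF-involution : ∀ {ℓ} (f : Vertex → Vertex) → (∀ x → f (f x) ≡ x) → (∀ {x y} → x ≼ y → f x ≼ f y) →
                (∀ x → ℓ x ≡ ℓ (f x)) → ∀ k → EF k ℓ ℓ (λ x y → f x ≡ y)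
EF-involution f inv mono lab zero = record
  { labels = λ { refl → lab _ }
  ; order  = λ { refl refl → mk⇔ mono (λ p → subst₂ _≼_ (inv _) (inv _) (mono p)) } }
EF-involution f inv mono lab (suc k) =
  (λ x → f x , EF-antitone k (λ { (old r) → r ; new → refl }) (EF-involution f inv mono lab k)) ,
  (λ y → f y , EF-antitone k (λ { (old r) → r ; new → inv y }) (EF-involution f inv mono lab k))

-- Contexts: replacing the subtree at a vertex.

data Context (u : Vertex) (R : Pairing) : Pairing where
  outside : ∀ {x} → ¬ u ≼ x → Context u R x x
  inside  : ∀ {x y} → R x y → Context u R (u ++ x) (u ++ y)

-- A vertex outside that is a prefix of some `u ++ y` is a prefix of `u`, hence of every `u ++ z`;
-- so the order between the two regions does not depend on the choice of vertex below `u`.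
Context-iso : ∀ u {ℓ ℓ′ ℓ₁ ℓ₁′ R} → (∀ x → ¬ u ≼ x → ℓ x ≡ ℓ′ x) →
  (∀ x → ℓ (u ++ x) ≡ ℓ₁ x) → (∀ x → ℓ′ (u ++ x) ≡ ℓ₁′ x) →
  PartialIso ℓ₁ ℓ₁′ R → PartialIso ℓ ℓ′ (Context u R)
Context-iso u {ℓ} {ℓ′} {R = R} out in₁ in₁′ e = record { labels = labels′ ; order = order′ }
  where
  labels′ : ∀ {x y} → Context u R x y → ℓ x ≡ ℓ′ y
  labels′ (outside u⋠x) = out _ u⋠x
  labels′ (inside r)    = trans (in₁ _) (trans (labels e r) (sym (in₁′ _)))

  outside-≼ : ∀ {x y z} → ¬ u ≼ x → x ≼ u ++ y → x ≼ u ++ z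
  outside-≼ {x} u⋠x p with ≼-++⁻ u x p
  ... | inj₁ u≼x = contradiction u≼x u⋠x
  ... | inj₂ x≼u = ≼-trans x≼u (_ , refl)

  order′ : ∀ {x y x′ y′} → Context u R x y → Context u R x′ y′ → x ≼ x′ ⇔ y ≼ y′
  order′ (outside _)   (outside _)    = ⇔-id _
  order′ (outside u⋠x) (inside _)     = mk⇔ (outside-≼ u⋠x) (outside-≼ u⋠x)
  order′ (inside _)    (outside u⋠x′) =
    mk⇔ (λ p → contradiction (≼-trans (_ , refl) p) u⋠x′) (λ p → contradiction (≼-trans (_ , refl) p) u⋠x′)
  order′ (inside r)    (inside r′)    =
    mk⇔ (++-mono-≼ u ∘ to (order e r r′) ∘ ++-cancel-≼ u) (++-mono-≼ u ∘ from (order e r r′) ∘ ++-cancel-≼ u)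

-- The labellings and the operations on them.

deep : ℕ → Labelling
deep zero    _       = true
deep (suc n) []      = false
deep (suc n) (_ ∷ x) = deep n x

deep-subtree : ∀ u n x → deep (length u + n) (u ++ x) ≡ deep n x
deep-subtree []      n x = refl
deep-subtree (_ ∷ u) n x = deep-subtree u n x

deep-short : ∀ {n} x → length x < n → deep n x ≡ false
deep-short []      z<s     = refl
deep-short (_ ∷ x) (s<s p) = deep-short x p

deep-long : ∀ {n} x → n ≤ length x → deep n x ≡ true
deep-long {zero}  x       _       = refl
deep-long {suc n} (_ ∷ x) (s≤s p) = deep-long x p

switch : Vertex → Vertex
switch []      = []
switch (b ∷ x) = opposite b ∷ x

switch-involutive : ∀ x → switch (switch x) ≡ x
switch-involutive []      = refl
switch-involutive (b ∷ x) = cong (_∷ x) (opposite-involutive b)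

switch-mono : ∀ {x y} → x ≼ y → switch x ≼ switch y
switch-mono {[]}    _          = _ , refl
switch-mono {b ∷ x} (ρ , refl) = ρ , refl

deep-switch : ∀ n x → deep n x ≡ deep n (switch x)
deep-switch zero    x       = refl
deep-switch (suc n) []      = refl
deep-switch (suc n) (_ ∷ x) = refl

-- The first letter `zero` becomes `suc zero`, so the vertex moves to the other half of the tree.
switch-leaves : ∀ {u y} → zero ∷ u ≼ y → ¬ zero ∷ u ≼ switch y
switch-leaves (_ , refl) (_ , ())

graft : Vertex → Labelling → Labelling → Labelling
graft []      ℓ ℓ₁ x       = ℓ₁ x
graft (b ∷ u) ℓ ℓ₁ []      = ℓ []
graft (b ∷ u) ℓ ℓ₁ (c ∷ x) with b ≟ c
... | yes _ = graft u (ℓ ∘ (c ∷_)) ℓ₁ x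
... | no _  = ℓ (c ∷ x)

graft-inside : ∀ u ℓ ℓ₁ x → graft u ℓ ℓ₁ (u ++ x) ≡ ℓ₁ x
graft-inside []      ℓ ℓ₁ x = refl
graft-inside (b ∷ u) ℓ ℓ₁ x with b ≟ b
... | yes _  = graft-inside u (ℓ ∘ (b ∷_)) ℓ₁ x
... | no b≢b = contradiction refl b≢b

graft-outside : ∀ u ℓ ℓ₁ x → ¬ u ≼ x → graft u ℓ ℓ₁ x ≡ ℓ x
graft-outside []      ℓ ℓ₁ x       u⋠x = contradiction (x , refl) u⋠x
graft-outside (b ∷ u) ℓ ℓ₁ []      _   = refl
graft-outside (b ∷ u) ℓ ℓ₁ (c ∷ x) u⋠x with b ≟ c
... | yes refl = graft-outside u (ℓ ∘ (b ∷_)) ℓ₁ x (u⋠x ∘ ++-mono-≼ (b ∷ []))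
... | no _     = refl

zeros : ℕ → Vertex
zeros n = replicate n zero

-- The branch of zeros runs through `ℓ` for `d` steps and continues in `ℓ₁`.
graft-zeros : ∀ d {ℓ ℓ₁} → (∀ i → i < d → ℓ (zeros i) ≡ false) → (∀ i → ℓ₁ (zeros i) ≡ false) →
              ∀ i → graft (zeros d) ℓ ℓ₁ (zeros i) ≡ false
graft-zeros zero    _  h₁ i       = h₁ i
graft-zeros (suc d) h  _  zero    = h zero z<s
graft-zeros (suc d) h  h₁ (suc i) = graft-zeros d (λ j j<d → h (suc j) (s<s j<d)) h₁ i

-- Finiteness of the number of game types.

-- FiniteIndex _~_: some equivalence relation with finitely many classes,
-- given by its colouring of A, refines _~_.
FiniteIndex : {A : Set} → (A → A → Set) → Set
FiniteIndex {A} _~_ = ∃[ N ] Σ[ c ∈ (A → Fin N) ] (∀ x y → c x ≡ c y → x ~ y)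

module _ {A : Set} where

  FiniteIndex-mono : {_~_ _≈_ : A → A → Set} → (∀ x y → x ~ y → x ≈ y) → FiniteIndex _~_ → FiniteIndex _≈_
  FiniteIndex-mono h (N , c , s) = N , c , λ x y eq → h x y (s x y eq)

  FiniteIndex-× : {_~_ _≈_ : A → A → Set} → FiniteIndex _~_ → FiniteIndex _≈_ →
                  FiniteIndex (λ x y → x ~ y × x ≈ y)
  FiniteIndex-× (M , c , s) (N , d , t) = _ , (λ x → combine (c x) (d x)) , λ x y eq →
    let eq₁ , eq₂ = combine-injective (c x) (d x) (c y) (d y) eq in s x y eq₁ , t x y eq₂

  FiniteIndex-∀ : ∀ n {_~⟨_⟩_ : A → Fin n → A → Set} → (∀ i → FiniteIndex (λ x y → x ~⟨ i ⟩ y)) →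
                  FiniteIndex (λ x y → ∀ i → x ~⟨ i ⟩ y)
  FiniteIndex-∀ zero    _ = 1 , (λ _ → zero) , λ _ _ _ ()
  FiniteIndex-∀ (suc n) h = FiniteIndex-mono (λ { _ _ (p , q) zero → p ; _ _ (p , q) (suc i) → q i })
    (FiniteIndex-× (h zero) (FiniteIndex-∀ n (h ∘ suc)))

data Paired {m} (ν ν′ : Vec Vertex m) : Pairing where
  at : ∀ i → Paired ν ν′ (lookup ν i) (lookup ν′ i)

module Games (em : ExcludedMiddle (lsuc 0ℓ)) where

  open Classical em

  FiniteIndex-⇔ : ∀ {A : Set} (Q : A → Set) → FiniteIndex (λ x y → Q x ⇔ Q y)
  FiniteIndex-⇔ Q = 2 , (λ x → colour (em₀ {Q x})) , λ x y → sound em₀ em₀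
    where
    colour : ∀ {X : Set} → Dec X → Fin 2
    colour (yes _) = zero
    colour (no _)  = suc zero

    sound : ∀ {X Y : Set} (d : Dec X) (e : Dec Y) → colour d ≡ colour e → X ⇔ Y
    sound (yes x) (yes y) _ = mk⇔ (λ _ → y) (λ _ → x)
    sound (no ¬x) (no ¬y) _ = mk⇔ (⊥-elim ∘ ¬x) (⊥-elim ∘ ¬y)

  -- Induction on `k`. With `c` colouring the positions that have one more vertex, the colour for
  -- `suc k` records which values of `c` are realised by adding a vertex; equal records supply all
  -- of Duplicator's answers.
  EF-finiteIndex : ∀ k m → FiniteIndex {Labelling × Vec Vertex m}
                                       (λ (ℓ , ν) (ℓ′ , ν′) → EF k ℓ ℓ′ (Paired ν ν′))
  EF-finiteIndex zero m = FiniteIndex-mono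
    (λ _ _ (h , h′) → record
      { labels = λ { (at i) → ⇔→≡ (h i) }
      ; order  = λ { (at i) (at j) → h′ i j } })
    (FiniteIndex-×
      (FiniteIndex-∀ m λ i → FiniteIndex-⇔ λ (ℓ , ν) → ℓ (lookup ν i) ≡ true)
      (FiniteIndex-∀ m λ i → FiniteIndex-∀ m λ j → FiniteIndex-⇔ λ (ℓ , ν) → lookup ν i ≼ lookup ν j))
  EF-finiteIndex (suc k) m with EF-finiteIndex k (suc m)
  ... | N , c , s = FiniteIndex-mono
    (λ (ℓ , ν) (ℓ′ , ν′) h →
      (λ x → let y , eq = to (h (c (ℓ , x ∷ ν))) (x , refl) in
        y , EF-antitone k cons (s _ _ (sym eq))) ,
      (λ y → let x , eq = from (h (c (ℓ′ , y ∷ ν′))) (y , refl) in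
        x , EF-antitone k cons (s _ _ eq)))
    (FiniteIndex-∀ N λ i → FiniteIndex-⇔ λ (ℓ , ν) → ∃[ x ] c (ℓ , x ∷ ν) ≡ i)
    where
    cons : ∀ {ν ν′ : Vec Vertex m} {x y x′ y′} → (Paired ν ν′ ⊹ x ↦ y) x′ y′ → Paired (x ∷ ν) (y ∷ ν′) x′ y′
    cons (old (at i)) = at (suc i)
    cons new          = at zero

  deep-repeats : ∀ k → ∃₂ λ n d → deep n ≈[ k ] deep (suc d + n)
  deep-repeats k with EF-finiteIndex k 0
  ... | N , c , s with pigeonhole (n<1+n N) (λ i → c (deep (toℕ i) , []))
  -- Reading `i < j` as `suc i ≤ j` makes the gap a successor; the vertex at which trees get plugged
  -- in will therefore differ from the root.
  ...   | i , j , i<j , eq with m≤n⇒∃[o]m+o≡n i<j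
  ...     | d , eq′ = toℕ i , d , subst (λ m → deep (toℕ i) ≈[ k ] deep m)
    (sym (trans (cong suc (+-comm d (toℕ i))) eq′)) (EF-antitone k (λ ()) (s _ _ eq))

  -- Duplicator copies moves outside `u` and follows the given strategy below `u`.
  Context-EF : ∀ k u {ℓ ℓ′ ℓ₁ ℓ₁′ R} → (∀ x → ¬ u ≼ x → ℓ x ≡ ℓ′ x) →
    (∀ x → ℓ (u ++ x) ≡ ℓ₁ x) → (∀ x → ℓ′ (u ++ x) ≡ ℓ₁′ x) →
    EF k ℓ₁ ℓ₁′ R → EF k ℓ ℓ′ (Context u R)
  Context-EF zero    u out in₁ in₁′ e = Context-iso u out in₁ in₁′ e
  Context-EF (suc k) u {ℓ} {ℓ′} {ℓ₁} {ℓ₁′} {R} out in₁ in₁′ e@(forth , back) = forth′ , back′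
    where
    inner : ∀ {S} → EF k ℓ₁ ℓ₁′ S → EF k ℓ ℓ′ (Context u S)
    inner = Context-EF k u out in₁ in₁′

    moved-inside : ∀ {x y x′ y′} → (Context u R ⊹ u ++ x ↦ (u ++ y)) x′ y′ → Context u (R ⊹ x ↦ y) x′ y′
    moved-inside (old (outside p)) = outside p
    moved-inside (old (inside r))  = inside (old r)
    moved-inside new               = inside new

    moved-outside : ∀ {x x′ y′} → ¬ u ≼ x → (Context u R ⊹ x ↦ x) x′ y′ → Context u R x′ y′
    moved-outside _   (old r) = r
    moved-outside u⋠x new     = outside u⋠x

    forth′ : ∀ x → ∃[ y ] EF k ℓ ℓ′ (Context u R ⊹ x ↦ y)
    forth′ x with em₀ {u ≼ x}
    ... | yes (x₁ , refl) = let y₁ , e′ = forth x₁ in u ++ y₁ , EF-antitone k moved-inside (inner e′)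
    -- A copied move leaves the inner position as it was; `EF-pred` drops one inner round to keep
    -- the counts equal.
    ... | no u⋠x          = x , EF-antitone k (moved-outside u⋠x) (inner (EF-pred k e))

    back′ : ∀ y → ∃[ x ] EF k ℓ ℓ′ (Context u R ⊹ x ↦ y)
    back′ y with em₀ {u ≼ y}
    ... | yes (y₁ , refl) = let x₁ , e′ = back y₁ in u ++ x₁ , EF-antitone k moved-inside (inner e′)
    ... | no u⋠y          = y , EF-antitone k (moved-outside u⋠y) (inner (EF-pred k e))

  -- The self-similar limit labelling.

  module Limit (n d : ℕ) where

    u : Vertex
    u = zeros (suc d)

    deepᵤ : Labelling
    deepᵤ = deep (suc d + n)

    deepᵤ-inside : ∀ x → deepᵤ (u ++ x) ≡ deep n x
    deepᵤ-inside x = subst (λ m → deep (m + n) (u ++ x) ≡ deep n x) (length-replicate (suc d)) (deep-subtree u n x)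

    unroll : ℕ → Labelling
    -- The value `false` makes `unroll-zeros` hold from the start.
    unroll zero    = λ _ → false
    unroll (suc i) = graft u deepᵤ (unroll i)

    -- The fixed point of graft u deepᵤ; a vertex x is reached after at most
    -- length x unfoldings.
    limit : Labelling
    limit x = unroll (suc (length x)) x

    -- Each unfolding that passes `u` removes a nonempty prefix, so any stage beyond the length of
    -- `x` ends outside `u`.
    unroll-stable : ∀ i j x → length x < i → length x < j → unroll i x ≡ unroll j x
    unroll-stable (suc i) (suc j) x (s≤s p) (s≤s q) with em₀ {u ≼ x}
    ... | yes (x₁ , refl) = trans (graft-inside u deepᵤ (unroll i) x₁) (trans
      (unroll-stable i j x₁ (≤-trans (s≤s (length-++-≤ʳ x₁ {zeros d})) p) (≤-trans (s≤s (length-++-≤ʳ x₁ {zeros d})) q))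
      (sym (graft-inside u deepᵤ (unroll j) x₁)))
    ... | no u⋠x = trans (graft-outside u deepᵤ (unroll i) x u⋠x) (sym (graft-outside u deepᵤ (unroll j) x u⋠x))

    limit-inside : ∀ x → limit (u ++ x) ≡ limit x
    limit-inside x = trans (graft-inside u deepᵤ _ x)
      (unroll-stable _ _ x (s≤s (length-++-≤ʳ x {zeros d})) (n<1+n _))

    limit-outside : ∀ x → ¬ u ≼ x → limit x ≡ deepᵤ x
    limit-outside x = graft-outside u deepᵤ _ x

    -- Between consecutive copies of `u` the branch stays at depths at most `d` of `deepᵤ`, whose
    -- labels begin only at depth `suc d + n`.
    unroll-zeros : ∀ i j → unroll i (zeros j) ≡ false
    unroll-zeros zero    j = refl
    unroll-zeros (suc i) j = graft-zeros (suc d)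
      (λ l l<d → deep-short (zeros l) (subst (_< suc d + n) (sym (length-replicate l)) (≤-trans l<d (m≤m+n (suc d) n))))
      (unroll-zeros i) j

    module _ {K} (repeats : deep n ≈[ K ] deepᵤ) where

      -- `ℓ` is the unfolding of `limit` just deep enough to contain `x`, with `deep n` plugged in
      -- at the last copy of `u`. Its equivalence with `deep n` holds for all `K` rounds, which
      -- leaves one to answer `x` when `k < K`.
      limit-approx : ∀ {k} → limit ≈[ k ] deep n → ∀ i x → length x < i →
                     ∃[ ℓ ] ℓ ≈[ K ] deep n × EF k limit ℓ (∅ ⊹ x ↦ x)
      limit-approx {k} e (suc i) x (s≤s p) with em₀ {u ≼ x}
      ... | no u⋠x = deepᵤ , ≈-sym K repeats ,
        EF-antitone k (λ { (old ()) ; new → outside u⋠x })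
          (Context-EF k u limit-outside limit-inside deepᵤ-inside e)
      ... | yes (x₁ , refl) with limit-approx e i x₁ (≤-trans (s≤s (length-++-≤ʳ x₁ {zeros d})) p)
      ...   | ℓ , ℓ≈deep , e′ = graft u deepᵤ ℓ ,
        -- Plugging `ℓ` instead of `deep n` into `deepᵤ` gives a `K`-equivalent of `deepᵤ`, hence
        -- again of `deep n`.
        ≈-trans K (EF-antitone K (λ ()) (Context-EF K u (graft-outside u deepᵤ ℓ) (graft-inside u deepᵤ ℓ) deepᵤ-inside ℓ≈deep))
                  (≈-sym K repeats) ,
        EF-antitone k (λ { (old ()) ; new → inside new })
          (Context-EF k u (λ y u⋠y → trans (limit-outside y u⋠y) (sym (graft-outside u deepᵤ ℓ y u⋠y)))
            limit-inside (graft-inside u deepᵤ ℓ) e′)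

      -- A vertex below u is moved off the spine by the automorphism
      -- exchanging the two subtrees of the root.
      response-outside : ∀ {k} → suc k ≤ K → ∀ y → ∃[ y′ ] ¬ u ≼ y′ × EF k deepᵤ (deep n) (∅ ⊹ y′ ↦ y)
      response-outside {k} k<K y with proj₁ (EF-mono k<K repeats) y
      ... | y₁ , e with em₀ {u ≼ y₁}
      ...   | no u⋠y₁  = y₁ , u⋠y₁ , EF-antitone k (λ { (old ()) ; new → new }) (EF-sym k e)
      ...   | yes u≼y₁ = switch y₁ , switch-leaves u≼y₁ ,
        EF-antitone k (λ { (old ()) ; new → _ , switch-involutive y₁ , new })
          (EF-trans k (EF-involution switch switch-involutive switch-mono (deep-switch (suc d + n)) k) (EF-sym k e))

      limit≈deep : ∀ k → k ≤ K → limit ≈[ k ] deep n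
      limit≈deep zero    _   = record { labels = λ () ; order = λ () }
      limit≈deep (suc k) k<K = forth , back
        where
        e : limit ≈[ k ] deep n
        e = limit≈deep k (<⇒≤ k<K)

        forth : ∀ x → ∃[ y ] EF k limit (deep n) (∅ ⊹ x ↦ y)
        forth x with limit-approx e (suc (length x)) x (n<1+n _)
        ... | ℓ , ℓ≈deep , e′ with proj₁ (EF-mono k<K ℓ≈deep) x
        ...   | y , e″ = y , EF-antitone k (λ { (old ()) ; new → _ , new , new }) (EF-trans k e′ e″)

        back : ∀ y → ∃[ x ] EF k limit (deep n) (∅ ⊹ x ↦ y)
        back y with response-outside k<K y
        ... | y′ , u⋠y′ , e′ = y′ , EF-antitone k (λ { (old ()) ; new → _ , outside u⋠y′ , new })
          (EF-trans k (Context-EF k u limit-outside limit-inside deepᵤ-inside e) e′)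

-- Binary Kripke trees and the game theorem for FO.

module _ {A B : Set} (f : A → B) where

  map-≡-++ : ∀ xs {ys zs} → map f xs ≡ ys ++ zs → ∃₂ λ xs₁ xs₂ → xs ≡ xs₁ ++ xs₂ × ys ≡ map f xs₁
  map-≡-++ xs       {[]}     _  = [] , xs , refl , refl
  map-≡-++ (x ∷ xs) {y ∷ ys} eq with ∷-injective eq
  ... | refl , eq′ with map-≡-++ xs {ys} eq′
  ...   | xs₁ , xs₂ , refl , refl = x ∷ xs₁ , xs₂ , refl , refl

  map-mono-≼ : ∀ {xs ys} → xs ≼ ys → map f xs ≼ map f ys
  map-mono-≼ {xs} (ρ , refl) = map f ρ , map-++ f xs ρ

word : Vertex → Word
word = map toℕ

word-injective : ∀ {x y} → word x ≡ word y → x ≡ y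
word-injective = map-injective toℕ-injective

word-⇔ : ∀ {x y} → x ≼ y ⇔ word x ⊑ word y
word-⇔ {x} {y} = mk⇔ (map-mono-≼ toℕ) cancel
  where
  cancel : word x ⊑ word y → x ≼ y
  cancel (ρ , eq) with map-≡-++ toℕ y eq
  ... | y₁ , y₂ , refl , eq′ = y₂ , cong (_++ y₂) (sym (word-injective eq′))

vertex : ∃₂ (λ τ x → τ ≡ word x) → Vertex
vertex (_ , x , _) = x

node : Vertex → ∃₂ (λ τ x → τ ≡ word x)
node x = word x , x , refl

module _ {AP : Set} (a : AP) where

  binaryTree : Labelling → KripkeTree AP
  binaryTree ℓ = record
    { nodes       = λ τ → ∃[ x ] τ ≡ word x
    ; isTree      = record
      { root   = []
      ; root∈  = [] , refl
      ; rooted = λ _ → _ , refl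
      ; closed = λ { (x , eq) (ρ , refl) → let x₁ , _ , _ , eq′ = map-≡-++ toℕ x (sym eq) in x₁ , eq′ }
      }
    ; nonBlocking = λ { (x , refl) →
        word (x ∷ʳ zero) , (x ∷ʳ zero , refl) , 0 , map-++ toℕ x (zero ∷ []) }
    ; label       = λ τ p → p ≡ a × ∃[ x ] τ ≡ word x × ℓ x ≡ true
    }

  label-⇔ : ∀ {ℓ x p} → KripkeTree.label (binaryTree ℓ) (word x) p ⇔ (p ≡ a × ℓ x ≡ true)
  label-⇔ {ℓ} = mk⇔
    (λ (p≡a , _ , eq , lab) → p≡a , trans (cong ℓ (word-injective eq)) lab)
    (λ (p≡a , lab) → p≡a , _ , refl , lab)

  rank : ∀ {m n} → Formula FO AP m n → ℕ
  rank (P _ _)  = 0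
  rank (_ ≤ᶠ _) = 0
  rank (_ ∈ᶠ _) = 0
  rank (¬ᶠ φ)   = rank φ
  rank (φ ∧ᶠ ψ) = rank φ ⊔ rank ψ
  rank (∃¹ φ)   = suc (rank φ)

  -- Each node quantifier spends a round, and atoms are read off the partial isomorphism left after
  -- all rounds. `R` may contain pairs beyond the current assignment.
  EF-⇔ : ∀ {k ℓ ℓ′ R m} (φ : Formula FO AP m 0) → rank φ ≤ k → EF k ℓ ℓ′ R →
         (ν : Vec (Node (binaryTree ℓ)) m) (ν′ : Vec (Node (binaryTree ℓ′)) m) →
         (∀ i → R (vertex (lookup ν i)) (vertex (lookup ν′ i))) →
         Sat (binaryTree ℓ) ν [] φ ⇔ Sat (binaryTree ℓ′) ν′ [] φ
  EF-⇔ {ℓ = ℓ} {ℓ′} (P p i) _ e ν ν′ r with lookup ν i | lookup ν′ i | r i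
  ... | _ , x , refl | _ , y , refl | rᵢ = mk⇔
    (λ (lift↑ l) → lift↑ (from (label-⇔ {ℓ′}) (subst (λ b → p ≡ a × b ≡ true) ℓx≡ℓ′y (to (label-⇔ {ℓ}) l))))
    (λ (lift↑ l) → lift↑ (from (label-⇔ {ℓ}) (subst (λ b → p ≡ a × b ≡ true) (sym ℓx≡ℓ′y) (to (label-⇔ {ℓ′}) l))))
    where
    ℓx≡ℓ′y : ℓ x ≡ ℓ′ y
    ℓx≡ℓ′y = labels (EF-mono z≤n e) rᵢ
  EF-⇔ (i ≤ᶠ j) _ e ν ν′ r with lookup ν i | lookup ν′ i | r i | lookup ν j | lookup ν′ j | r j
  ... | _ , x , refl | _ , x′ , refl | rᵢ | _ , y , refl | _ , y′ , refl | rⱼ = mk⇔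
    (λ (lift↑ (_ , p)) → lift↑ ((y′ , refl) , to word-⇔ (to x≼y (from word-⇔ p))))
    (λ (lift↑ (_ , p)) → lift↑ ((y , refl) , to word-⇔ (from x≼y (from word-⇔ p))))
    where
    x≼y : x ≼ y ⇔ x′ ≼ y′
    x≼y = order (EF-mono z≤n e) rᵢ rⱼ
  EF-⇔ (¬ᶠ φ) q e ν ν′ r = ¬-cong-⇔ (EF-⇔ φ q e ν ν′ r)
  EF-⇔ (φ ∧ᶠ ψ) q e ν ν′ r =
    EF-⇔ φ (≤-trans (m≤m⊔n _ _) q) e ν ν′ r ×-⇔ EF-⇔ ψ (≤-trans (m≤n⊔m (rank φ) _) q) e ν ν′ r
  EF-⇔ {R = R} (∃¹ φ) (s≤s q) (forth , back) ν ν′ r = mk⇔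
    (λ (v , s) → let y , e = forth (vertex v) in
      node y , to (EF-⇔ φ q e (v ∷ ν) (node y ∷ ν′) λ { zero → new ; (suc i) → old (r i) }) s)
    (λ (v′ , s) → let x , e = back (vertex v′) in
      node x , from (EF-⇔ φ q e (node x ∷ ν) (v′ ∷ ν′) λ { zero → new ; (suc i) → old (r i) }) s)

-- Short vertices and the branch of zeros.

short-vertices : ∀ n → ∃[ xs ] (∀ (x : Vertex) → length x < n → x ∈ˡ xs)
short-vertices zero    = [] , λ _ ()
short-vertices (suc n) with short-vertices n
... | xs , complete = [] ∷ map (zero ∷_) xs ++ map (suc zero ∷_) xs , λ
  { []             _       → here refl
  ; (zero ∷ x)     (s<s p) → there (∈-++⁺ˡ (∈-map⁺ _ (complete x p)))
  ; (suc zero ∷ x) (s<s p) → there (∈-++⁺ʳ (map (zero ∷_) xs) (∈-map⁺ _ (complete x p))) }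

zerosWord : Subset
zerosWord τ = ∃[ i ] τ ≡ word (zeros i)

zeros-∷ʳ : ∀ i → zeros i ∷ʳ zero ≡ zeros (suc i)
zeros-∷ʳ zero    = refl
zeros-∷ʳ (suc i) = cong (zero ∷_) (zeros-∷ʳ i)

zeros-++⁻ : ∀ i {x y} → zeros i ≡ x ++ y → x ≡ zeros (length x)
zeros-++⁻ i       {[]}    _  = refl
zeros-++⁻ (suc i) {_ ∷ x} eq with ∷-injective eq
... | refl , eq′ = cong (zero ∷_) (zeros-++⁻ i eq′)

word-zeros-∷ʳ : ∀ i {τ n} → word (zeros i) ≡ τ ∷ʳ n → n ≡ 0
word-zeros-∷ʳ (suc zero)    {[]}    refl = refl
word-zeros-∷ʳ (suc i)       {m ∷ τ} eq   = word-zeros-∷ʳ i (proj₂ (∷-injective eq))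
word-zeros-∷ʳ (suc (suc i)) {[]}    ()
word-zeros-∷ʳ zero          {[]}    ()
word-zeros-∷ʳ zero          {_ ∷ _} ()

module _ {AP : Set} (a : AP) (ℓ : Labelling) where

  open KripkeTree (binaryTree a ℓ)

  zerosWord-isPath : IsPath nodes zerosWord
  zerosWord-isPath = record
    { isSubtree = record
      { included = λ (i , eq) → zeros i , eq
      ; isTree   = record
        { root   = []
        ; root∈  = 0 , refl
        ; rooted = λ _ → _ , refl
        ; closed = λ { (i , eq) (ρ , refl) →
            let x , _ , eq₁ , eq₂ = map-≡-++ toℕ (zeros i) (sym eq) in
            length x , trans eq₂ (cong word (zeros-++⁻ i eq₁)) }
        }
      }
    ; atMostOne = λ { _ ((i , eq) , _ , refl) ((j , eq′) , _ , refl) →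
        cong (_ ∷ʳ_) (trans (word-zeros-∷ʳ i (sym eq)) (sym (word-zeros-∷ʳ j (sym eq′)))) }
    }

list-bound : (xs : List Word) → ∃[ n ] (∀ {τ} → τ ∈ˡ xs → length τ < n)
list-bound []       = 0 , λ ()
list-bound (x ∷ xs) with list-bound xs
... | n , below = suc (length x) ⊔ n , λ
  { (here refl) → m≤m⊔n _ n ; (there τ∈) → ≤-trans (below τ∈) (m≤n⊔m (suc (length x)) n) }

-- The member `word (zeros n)` is too long for a list whose words all have length below `n`.
zerosWord-infinite : ¬ FiniteSubset zerosWord
zerosWord-infinite (xs , zeros⊆xs , _) with list-bound xs
... | n , below = <-irrefl (trans (length-map toℕ (zeros n)) (length-replicate n)) (below (zeros⊆xs (n , refl)))

-- Acceptance separates the logics.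

accepted : ∀ {AP} → AP → Sentence coWMPL AP
accepted a = ¬ᶠ ∃² cowmpl
  -- The least node of the tree is its root, and a path containing it starts there.
  (∃¹ ((zero ∈ᶠ zero) ∧ᶠ (¬ᶠ ∃¹ (¬ᶠ (suc zero ≤ᶠ zero)))) ∧ᶠ (¬ᶠ ∃¹ ((zero ∈ᶠ zero) ∧ᶠ P a zero)))

module Separation (em : ExcludedMiddle (lsuc 0ℓ)) where

  open Classical em
  open Games em

  binaryTree-finitelyBranching : ∀ {AP} (a : AP) ℓ → FinitelyBranching (KripkeTree.nodes (binaryTree a ℓ))
  binaryTree-finitelyBranching a ℓ (x , refl) = ⊆-list⇒finite (map (λ b → word (x ∷ʳ b)) (allFin 2)) child
    where
    child : ∀ {σ} → σ ∈ Child (KripkeTree.nodes (binaryTree a ℓ)) (word x) → σ ∈ˡ map (λ b → word (x ∷ʳ b)) (allFin 2)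
    child ((y , eq) , n , refl) with ∈-map⁻ toℕ (subst (n ∈ˡ_) eq (∈-++⁺ʳ (word x) (here refl)))
    ... | b , _ , refl = subst (_∈ˡ _) (map-++ toℕ x (b ∷ [])) (∈-map⁺ (λ b → word (x ∷ʳ b)) (∈-allFin b))

  binaryTree∈ᶜ : ∀ {AP} (a : AP) ℓ C → binaryTree a ℓ ∈ᶜ C
  binaryTree∈ᶜ a ℓ allTrees          = tt
  binaryTree∈ᶜ a ℓ finitelyBranching = binaryTree-finitelyBranching a ℓ

  -- A path avoiding `a` has only vertices of length below `n`, of which there are finitely many.
  deep-acceptance : ∀ {AP} (a : AP) n → Acceptance a (binaryTree a (deep n))
  deep-acceptance a n X isPath _ inf = dne₀ λ none →
    let xs , complete = short-vertices n in
    inf (⊆-list⇒finite (map word xs) λ {τ} τ∈X →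
      let x , eq = IsPath.included isPath τ∈X in
      subst (_∈ˡ map word xs) (sym eq) (∈-map⁺ word (complete x (short none τ∈X eq))))
    where
    short : ¬ (∃[ τ ] τ ∈ X × a ∈ KripkeTree.label (binaryTree a (deep n)) τ) →
            ∀ {τ x} → τ ∈ X → τ ≡ word x → length x < n
    short none {x = x} τ∈X refl with length x <? n
    ... | yes p = p
    ... | no ¬p = contradiction (_ , τ∈X , from (label-⇔ a {deep n}) (refl , deep-long x (≮⇒≥ ¬p))) none

  ¬zeros-acceptance : ∀ {AP} (a : AP) ℓ → (∀ i → ℓ (zeros i) ≡ false) → ¬ Acceptance a (binaryTree a ℓ)
  ¬zeros-acceptance a ℓ unlabelled acc with acc zerosWord (zerosWord-isPath a ℓ) refl zerosWord-infinite
  ... | _ , (i , refl) , lab with trans (sym (unlabelled i)) (proj₂ (to (label-⇔ a {ℓ}) lab))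
  ...   | ()

  -- The number of rounds is the quantifier rank of `φ`: `deep n` has the property and `limit` lacks
  -- it, yet `φ` cannot tell them apart.
  FO-inexpressible : ∀ {AP} C (a : AP) (φ : Sentence FO AP) → ¬ Expresses C φ (Acceptance a)
  FO-inexpressible C a φ expr with deep-repeats (rank a φ)
  ... | n , d , repeats =
    ¬zeros-acceptance a limit (λ i → unroll-zeros (suc (length (zeros i))) i)
      (to (expr (binaryTree a limit) (binaryTree∈ᶜ a limit C))
        (from (EF-⇔ a φ ≤-refl (limit≈deep repeats (rank a φ) ≤-refl) [] [] λ ())
          (from (expr (binaryTree a (deep n)) (binaryTree∈ᶜ a (deep n) C)) (deep-acceptance a n))))
    where open Limit n d

  WMPL-inexpressible : ∀ {AP} C → FiniteSet AP → (a : AP) (φ : Sentence WMPL AP) → ¬ Expresses C φ (Acceptance a)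
  WMPL-inexpressible C fin a φ expr with WMPL≤ {FO} {C} _ fin φ
  ... | ψ , φ⇔ψ = FO-inexpressible C a ψ λ K K∈C → expr K K∈C ⇔-∘ ⇔-sym (φ⇔ψ K K∈C)

  accepted-expresses : ∀ {AP} C (a : AP) → Expresses C (accepted a) (Acceptance a)
  accepted-expresses C a K _ = mk⇔ sound complete
    where
    open KripkeTree K

    sound : K ⊨ accepted a → Acceptance a K
    sound s X isPath root≡ inf = dne₀ λ none → s ((X , isPath) , inf ,
      ((root , root∈) , lift↑ (subst (_∈ X) root≡ (IsPath.root∈ isPath)) ,
        λ ((_ , τ∈) , r⋢τ) → r⋢τ (lift↑ (τ∈ , rooted τ∈))) ,
      λ ((τ , _) , lift↑ τ∈X , lift↑ lab) → none (τ , τ∈X , lab))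

    complete : Acceptance a K → K ⊨ accepted a
    complete acc ((X , isPath) , inf , ((r , _) , lift↑ r∈X , least) , none) =
      let r⊑root = dne₀ λ r⋢root → least ((root , root∈) , λ (lift↑ (_ , p)) → r⋢root p)
          -- The root of the path is a prefix of `r`, and `r` of the root of the tree, which in turn
          -- is a prefix of every node.
          root≡  = ≼-antisym (≼-trans (IsPath.rooted isPath r∈X) r⊑root)
                             (rooted (IsPath.included isPath (IsPath.root∈ isPath)))
          τ , τ∈X , lab = acc X isPath root≡ inf
      in none ((τ , IsPath.included isPath τ∈X) , lift↑ τ∈X , lift↑ lab)

  -- The translation of `accepted` expresses acceptance in `MPL`. A single proposition suffices, so
  -- `AP` is `⊤`.
  MPL≰WMPL : ∀ C → ¬ (MPL ≤[ C ] WMPL)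
  MPL≰WMPL C MPL≤WMPL with coWMPL≤MPL {C} ⊤ (1 , ↔-sym 1↔⊤) (accepted tt)
  ... | ψ , acc⇔ψ with MPL≤WMPL ⊤ (1 , ↔-sym 1↔⊤) ψ
  ...   | χ , ψ⇔χ = WMPL-inexpressible C (1 , ↔-sym 1↔⊤) tt χ λ K K∈C →
    accepted-expresses C tt K K∈C ⇔-∘ (⇔-sym (acc⇔ψ K K∈C) ⇔-∘ ⇔-sym (ψ⇔χ K K∈C))

theorem3 : ExcludedMiddle (lsuc 0ℓ) → (C : TreeClass) →
    ((AP : Set) → FiniteSet AP → (a : AP) →
    (φ : Sentence WMPL AP) → ¬ Expresses C φ (Acceptance a))
    × WMPL ≡[ C ] FO
    × MPL ≡[ C ] coWMPL
    × WMPL <[ C ] MPL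
theorem3 em C =
  (λ AP → WMPL-inexpressible C) ,
  (WMPL≤ , FO≤) ,
  (MPL≤coWMPL , coWMPL≤MPL) ,
  WMPL≤ , MPL≰WMPL C
  where
  open Classical em
  open Separation em
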